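{- Let $H = (V, A, B)$ be a cross-intersecting family such that there is no pair $e_1, e_2 \in A \cup B$ with $e_1 \subsetneq e_2$ (i.e. $(V, A \cup B)$ is a Sperner system). Then $\chi(H) \leq 3$ or, up to exchanging the roles of $A$ and $B$, $V = \{v_1, \dots, v_m, u_1, \dots, u_l\}$, $B = \{ \{v_1, \dots, v_m\}, \{u_1, \dots, u_l\} \}$ and $A = \{ \{v_i, u_j\} \text{ for all } i, j \}$, where $m, l \geq 2$.
   Context: A hypergraph is a pair $(V,E)$ where $V$ is a set of vertices and $E$ is a set of subsets of $V$ (edges). A cross-intersecting family $H = (V, A, B)$ is a hypergraph with vertex set $V$ and edge set $E = A \cup B$ such that every $a \in A$ intersects every $b \in B$, and $A$, $B$ are not empty. A coloring of the vertices of $H$ is proper if there are no monochromatic edges; the chromatic number $\chi(H)$ is the minimal number of colors that admits a proper coloring.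
   Formalization: V is finite, and in the exceptional case V = {v_i, u_j} is asserted only for vertices lying on some edge (an isolated vertex, or infinite parts, refute the literal claim); χ(H) is assumed to exist, which excludes only A = B = {{v}}. -}

module Defs where

open import Data.Fin using (Fin)
open import Data.Fin.Subset using (Subset; _∈_; _∩_; _∪_; _⊂_; ⁅_⁆; ⋃; Nonempty)
open import Data.List using (tabulate)
open import Data.Nat using (ℕ; _≤_)
open import Data.Product using (_×_; ∃; ∃-syntax)
open import Data.Sum using (_⊎_)
open import Function.Bundles using (_⇔_)
open import Function.Definitions using (Injective)
open import Level using (0ℓ)
open import Relation.Binary.PropositionalEquality using (_≡_; _≢_)
open import Relation.Nullary using (¬_)
open import Relation.Unary using (Pred; Decidable; Satisfiable)
import Relation.Unary as U
open import Relation.Unary.Properties using (_∪?_)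

-- The vertex set is Fin n.  A family of edges is a decidable predicate on
-- subsets of Fin n; classically these are exactly the sets of subsets.
record Hypergraph (n : ℕ) : Set₁ where
  field
    Edge  : Pred (Subset n) 0ℓ
    edge? : Decidable Edge

-- A and B may overlap.
record CrossIntersectingFamily (n : ℕ) : Set₁ where
  field
    A B        : Pred (Subset n) 0ℓ
    A?         : Decidable A
    B?         : Decidable B
    A-nonempty : Satisfiable A
    B-nonempty : Satisfiable B
    cross      : ∀ {a b} → A a → B b → Nonempty (a ∩ b)

  hypergraph : Hypergraph n
  hypergraph = record { Edge = A U.∪ B ; edge? = A? ∪? B? }

module _ {n : ℕ} (H : Hypergraph n) where
  open Hypergraph H

  Sperner : Set
  Sperner = ∀ {e₁ e₂} → Edge e₁ → Edge e₂ → ¬ (e₁ ⊂ e₂)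

  Monochromatic : ∀ {k} → (Fin n → Fin k) → Subset n → Set
  Monochromatic c e = ∀ {x y} → x ∈ e → y ∈ e → c x ≡ c y

  Proper : ∀ {k} → (Fin n → Fin k) → Set
  Proper c = ∀ {e} → Edge e → ¬ Monochromatic c e

  Colorable : ℕ → Set
  Colorable k = ∃[ c ] Proper {k} c

  -- One-vertex edges are monochromatic under every coloring, so a hypergraph
  -- that has one has no chromatic number.
  IsChromaticNumber : ℕ → Set
  IsChromaticNumber χ = Colorable χ × (∀ {k} → Colorable k → χ ≤ k)

image : ∀ {m n} → (Fin m → Fin n) → Subset n
image v = ⋃ (tabulate (λ i → ⁅ v i ⁆))

record Exceptional {n : ℕ} (A B : Pred (Subset n) 0ℓ) : Set where
  field
    m l         : ℕ
    2≤m         : 2 ≤ m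
    2≤l         : 2 ≤ l
    v           : Fin m → Fin n
    u           : Fin l → Fin n
    v-injective : Injective _≡_ _≡_ v
    u-injective : Injective _≡_ _≡_ u
    v≢u         : ∀ i j → v i ≢ u j
    -- V = {v₁, …, vₘ, u₁, …, uₗ}, up to vertices that lie on no edge: adding
    -- such a vertex changes neither A, B nor the chromatic number.
    V-covered   : ∀ {e x} → (A U.∪ B) e → x ∈ e →
                  (∃[ i ] x ≡ v i) ⊎ (∃[ j ] x ≡ u j)
    B-edges     : ∀ e → B e ⇔ (e ≡ image v ⊎ e ≡ image u)
    A-edges     : ∀ e → A e ⇔ (∃[ i ] ∃[ j ] e ≡ ⁅ v i ⁆ ∪ ⁅ u j ⁆)

{-# OPTIONS --safe #-}
module Submission where

-- Suppose H is not 3-colorable, so that every 3-coloring has a monochromatic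
-- edge.  If a ∈ A and b ∈ B, the complement of a ∪ b contains no edge, so every
-- 2-coloring of a ∪ b has a monochromatic edge.  Coloring x and a \ b against
-- b \ x shows that a ∩ b = {x}; coloring b \ x and p against a \ p gives, for
-- every p ∈ a \ b, an edge f with p ∈ f ⊆ {p} ∪ (b \ x), which has two vertices
-- if f ∈ A.  Exchanging roles, every q ∈ b \ a lies on an edge
-- g ⊆ {q} ∪ (a \ x), which has two vertices if g ∈ B.  If g ∈ A and
-- p ∈ g \ q, then |f ∩ g| = 1 forces q ∉ f, so f \ a is strictly smaller than
-- b \ a; by descent there is an edge with two vertices, say {p, q} ∈ A.
-- Coloring x against b \ x against the rest shows that each b ∈ B has a disjoint
-- b′ ∈ B.  Starting from {p, q} with p ∈ b and q ∈ b′, the edges f above have two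
-- vertices each, and they fill up the complete bipartite graph between b and b′.

open import Defs
open import Data.Empty using (⊥-elim)
open import Data.Fin using (Fin; zero; suc; _≟_)
open import Data.Fin.Properties using (all?; any?; suc-injective)
open import Data.Fin.Subset
  using (Subset; inside; outside; _∈_; _∉_; _⊆_; _⊂_; _∩_; _∪_; ∁; ⁅_⁆; ∣_∣)
open import Data.Fin.Subset.Induction using (⊂-wellFounded)
open import Data.Fin.Subset.Properties
open import Data.Nat using (ℕ; zero; suc; _≤_; z≤n; s≤s; _≤?_)
open import Data.Product using (_×_; _,_; proj₁; proj₂; ∃; ∃-syntax)
open import Data.Sum using (_⊎_; inj₁; inj₂)
import Data.Sum as Sum
open import Data.Vec using ([]; _∷_; here; there)
open import Function.Base using (_∘_; id)
open import Function.Bundles using (mk⇔)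
open import Function.Definitions using (Injective)
open import Induction.WellFounded using (Acc; acc)
open import Level using (0ℓ)
open import Relation.Binary.PropositionalEquality
open import Relation.Nullary using (¬_; Dec; yes; no; ¬?; _×-dec_; _⊎-dec_; _→-dec_; contradiction)
open import Relation.Nullary.Decidable using (decidable-stable; map′)
open import Relation.Unary using (Pred; Decidable)

private
  variable
    n : ℕ

-- Two-vertex sets.

pair : Fin n → Fin n → Subset n
pair x y = ⁅ x ⁆ ∪ ⁅ y ⁆

∈-pair⁻ : ∀ {x y z : Fin n} → z ∈ pair x y → z ≡ x ⊎ z ≡ y
∈-pair⁻ {x = x} {y} = Sum.map (x∈⁅y⁆⇒x≡y x) (x∈⁅y⁆⇒x≡y y) ∘ x∈p∪q⁻ ⁅ x ⁆ ⁅ y ⁆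

∈-pairˡ : ∀ (x y : Fin n) → x ∈ pair x y
∈-pairˡ x y = x∈p∪q⁺ (inj₁ (x∈⁅x⁆ x))

∈-pairʳ : ∀ (x y : Fin n) → y ∈ pair x y
∈-pairʳ x y = x∈p∪q⁺ (inj₂ (x∈⁅x⁆ y))

∉-pair : ∀ {x y u v z : Fin n} → x ≢ u → x ≢ v → y ≢ u → y ≢ v →
         z ∈ pair x y → z ∉ pair u v
∉-pair x≢u x≢v y≢u y≢v z∈xy z∈uv with ∈-pair⁻ z∈xy
... | inj₁ refl = Sum.[ x≢u , x≢v ] (∈-pair⁻ z∈uv)
... | inj₂ refl = Sum.[ y≢u , y≢v ] (∈-pair⁻ z∈uv)

pair-⊆ : ∀ {x y : Fin n} {e} → x ∈ e → y ∈ e → pair x y ⊆ e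
pair-⊆ x∈e y∈e z∈xy with ∈-pair⁻ z∈xy
... | inj₁ refl = x∈e
... | inj₂ refl = y∈e

pair-comm : ∀ (x y : Fin n) → pair x y ≡ pair y x
pair-comm x y = ∪-comm ⁅ x ⁆ ⁅ y ⁆

⊆⊎∃∉ : ∀ (p q : Subset n) → p ⊆ q ⊎ (∃[ x ] x ∈ p × x ∉ q)
⊆⊎∃∉ p q with any? (λ x → (x ∈? p) ×-dec ¬? (x ∈? q))
... | yes w = inj₂ w
... | no ¬w = inj₁ λ {x} x∈p → decidable-stable (x ∈? q) λ x∉q → ¬w (x , x∈p , x∉q)

-- Listing a subset as an injective family, the form in which `Exceptional` presents its two sides.

enumerate : (p : Subset n) → Fin ∣ p ∣ → Fin n
enumerate (inside  ∷ p) zero    = zero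
enumerate (inside  ∷ p) (suc i) = suc (enumerate p i)
enumerate (outside ∷ p) i       = suc (enumerate p i)

enumerate-∈ : ∀ (p : Subset n) i → enumerate p i ∈ p
enumerate-∈ (inside  ∷ p) zero    = here
enumerate-∈ (inside  ∷ p) (suc i) = there (enumerate-∈ p i)
enumerate-∈ (outside ∷ p) i       = there (enumerate-∈ p i)

enumerate-injective : ∀ (p : Subset n) → Injective _≡_ _≡_ (enumerate p)
enumerate-injective (inside  ∷ p) {zero}  {zero}  _  = refl
enumerate-injective (inside  ∷ p) {suc i} {suc j} eq =
  cong suc (enumerate-injective p (suc-injective eq))
enumerate-injective (outside ∷ p) eq = enumerate-injective p (suc-injective eq)

enumerate-surjective : ∀ (p : Subset n) {x} → x ∈ p → ∃[ i ] x ≡ enumerate p i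
enumerate-surjective (inside  ∷ p) here      = zero , refl
enumerate-surjective (inside  ∷ p) (there x∈p) with enumerate-surjective p x∈p
... | i , refl = suc i , refl
enumerate-surjective (outside ∷ p) (there x∈p) with enumerate-surjective p x∈p
... | i , refl = i , refl

∈-image⁺ : ∀ {m} (v : Fin m → Fin n) i → v i ∈ image v
∈-image⁺ v zero    = x∈p∪q⁺ (inj₁ (x∈⁅x⁆ (v zero)))
∈-image⁺ v (suc i) = x∈p∪q⁺ (inj₂ (∈-image⁺ (v ∘ suc) i))

∈-image⁻ : ∀ {m} (v : Fin m → Fin n) {x} → x ∈ image v → ∃[ i ] x ≡ v i
∈-image⁻ {m = zero}  v x∈⊥ = contradiction x∈⊥ ∉⊥
∈-image⁻ {m = suc m} v x∈ with x∈p∪q⁻ ⁅ v zero ⁆ (image (v ∘ suc)) x∈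
... | inj₁ x∈⁅v₀⁆ = zero , x∈⁅y⁆⇒x≡y (v zero) x∈⁅v₀⁆
... | inj₂ x∈rest with ∈-image⁻ (v ∘ suc) x∈rest
...   | i , x≡vᵢ = suc i , x≡vᵢ

image-enumerate : ∀ (p : Subset n) → image (enumerate p) ≡ p
image-enumerate p = ⊆-antisym image⊆p p⊆image
  where
  image⊆p : image (enumerate p) ⊆ p
  image⊆p x∈ with ∈-image⁻ (enumerate p) x∈
  ... | i , refl = enumerate-∈ p i

  p⊆image : p ⊆ image (enumerate p)
  p⊆image x∈p with enumerate-surjective p x∈p
  ... | i , refl = ∈-image⁺ (enumerate p) i

distinct⇒2≤ : ∀ {m} {i j : Fin m} → i ≢ j → 2 ≤ m
distinct⇒2≤ {suc zero}    {zero} {zero} i≢j = contradiction refl i≢j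
distinct⇒2≤ {suc (suc m)} _ = s≤s (s≤s z≤n)

2≤∣_∣ : ∀ (p : Subset n) {x y} → x ∈ p → y ∈ p → x ≢ y → 2 ≤ ∣ p ∣
2≤∣ p ∣ x∈p y∈p x≢y with enumerate-surjective p x∈p | enumerate-surjective p y∈p
... | i , refl | j , refl = distinct⇒2≤ (x≢y ∘ cong (enumerate p))

-- Three-class colorings and the combinatorial hypotheses.

classify : ∀ {P Q : Set} → Dec P → Dec Q → Fin 3
classify (yes _) _       = zero
classify (no _)  (yes _) = suc zero
classify (no _)  (no _)  = suc (suc zero)

InClass : Fin 3 → Set → Set → Set
InClass zero             P Q = P
InClass (suc zero)       P Q = ¬ P × Q
InClass (suc (suc zero)) P Q = ¬ P × ¬ Q

classify-sound : ∀ {P Q : Set} (P? : Dec P) (Q? : Dec Q) → InClass (classify P? Q?) P Q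
classify-sound (yes p) _       = p
classify-sound (no ¬p) (yes q) = ¬p , q
classify-sound (no ¬p) (no ¬q) = ¬p , ¬q

-- The hypotheses are put in a form symmetric in `A` and `B`, so that `swap` yields every later
-- result with the roles exchanged.
record Uncolorable (A B : Pred (Subset n) 0ℓ) : Set where
  Edge : Pred (Subset n) 0ℓ
  Edge e = A e ⊎ B e

  field
    A?            : Decidable A
    B?            : Decidable B
    cross         : ∀ {a b} → A a → B b → ∃[ x ] x ∈ a × x ∈ b
    ⊆⇒≡           : ∀ {e f} → Edge e → Edge f → e ⊆ f → e ≡ f
    distinct      : ∀ {e} → Edge e → ∃[ x ] ∃[ y ] x ∈ e × y ∈ e × x ≢ y
    monochromatic : ∀ (c : Fin n → Fin 3) →
                    ∃[ e ] Edge e × (∀ {x y} → x ∈ e → y ∈ e → c x ≡ c y)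

  other : ∀ {e} → Edge e → ∀ x → ∃[ y ] y ∈ e × y ≢ x
  other e∈ x with distinct e∈
  ... | y , z , y∈e , z∈e , y≢z with y ≟ x
  ...   | no  y≢x  = y , y∈e , y≢x
  ...   | yes refl = z , z∈e , y≢z ∘ sym

  -- An edge has a vertex other than `q`, which can only be `p`, and vice versa.
  pair-edge : ∀ {p q e} → Edge e → (∀ {z} → z ∈ e → z ≡ p ⊎ z ≡ q) → e ≡ pair p q
  pair-edge {p} {q} {e} e∈ e⊆pq = ⊆-antisym e⊆ (pair-⊆ p∈e q∈e)
    where
    e⊆ : e ⊆ pair p q
    e⊆ z∈e with e⊆pq z∈e
    ... | inj₁ refl = ∈-pairˡ p q
    ... | inj₂ refl = ∈-pairʳ p q

    p∈e : p ∈ e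
    p∈e with other e∈ q
    ... | z , z∈e , z≢q with e⊆pq z∈e
    ...   | inj₁ refl = z∈e
    ...   | inj₂ z≡q  = contradiction z≡q z≢q

    q∈e : q ∈ e
    q∈e with other e∈ p
    ... | z , z∈e , z≢p with e⊆pq z∈e
    ...   | inj₁ z≡p  = contradiction z≡p z≢p
    ...   | inj₂ refl = z∈e

  -- `P` takes precedence over `Q`, so overlapping predicates still give three disjoint classes.
  -- `distinct` serves only to supply a vertex, whose class is that of the whole edge.
  block : ∀ {P Q : Pred (Fin n) 0ℓ} → Decidable P → Decidable Q →
          ∃[ e ] ∃[ k ] Edge e × (∀ {z} → z ∈ e → InClass k (P z) (Q z))
  block {P} {Q} P? Q? with monochromatic (λ z → classify (P? z) (Q? z))
  ... | e , e∈ , mono with distinct e∈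
  ...   | x , _ , x∈e , _ =
    e , classify (P? x) (Q? x) , e∈ ,
    λ {z} z∈e → subst (λ k → InClass k (P z) (Q z)) (mono z∈e x∈e)
                      (classify-sound (P? z) (Q? z))

swap : {A B : Pred (Subset n) 0ℓ} → Uncolorable A B → Uncolorable B A
swap U = record
  { A?            = B?
  ; B?            = A?
  ; cross         = λ b∈ a∈ → let x , x∈a , x∈b = cross a∈ b∈ in x , x∈b , x∈a
  ; ⊆⇒≡           = λ e∈ f∈ → ⊆⇒≡ (Sum.swap e∈) (Sum.swap f∈)
  ; distinct      = distinct ∘ Sum.swap
  ; monochromatic = λ c → let e , e∈ , mono = monochromatic c in e , Sum.swap e∈ , mono
  }
  where open Uncolorable U

-- Edges forced by particular colorings.

module _ {A B : Pred (Subset n) 0ℓ} (U : Uncolorable A B) where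
  open Uncolorable U

  -- The third color is spent on the complement of `a ∪ b`. It holds no edge, since edges of `A`
  -- meet `b` and edges of `B` meet `a`.
  split : ∀ {a b} → A a → B b → {S : Pred (Fin n) 0ℓ} → Decidable S →
          ∃[ e ] Edge e × (∀ {z} → z ∈ e → z ∈ a ⊎ z ∈ b) ×
                 ((∀ {z} → z ∈ e → S z) ⊎ (∀ {z} → z ∈ e → ¬ S z))
  split {a} {b} a∈ b∈ S?
    with block (λ z → ((z ∈? a) ⊎-dec (z ∈? b)) ×-dec S? z) (λ z → (z ∈? a) ⊎-dec (z ∈? b))
  ... | e , zero , e∈ , inP = e , e∈ , proj₁ ∘ inP , inj₁ (proj₂ ∘ inP)
  ... | e , suc zero , e∈ , inQ =
    e , e∈ , proj₂ ∘ inQ , inj₂ (λ z∈e Sz → proj₁ (inQ z∈e) (proj₂ (inQ z∈e) , Sz))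
  ... | e , suc (suc zero) , inj₁ e∈A , out =
    let z , z∈e , z∈b = cross e∈A b∈ in contradiction (inj₂ z∈b) (proj₂ (out z∈e))
  ... | e , suc (suc zero) , inj₂ e∈B , out =
    let z , z∈a , z∈e = cross a∈ e∈B in contradiction (inj₁ z∈a) (proj₂ (out z∈e))

  -- Split `a ∪ b` into `x` with `a` minus `b`, and `b` minus `x`. The first part lies in `a` but
  -- misses a second common vertex `y`; the second lies in `b` but misses `x`. By the Sperner
  -- property neither contains an edge.
  ∩-unique : ∀ {a b x y} → A a → B b → x ∈ a → x ∈ b → y ∈ a → y ∈ b → y ≡ x
  ∩-unique {a} {b} {x} {y} a∈ b∈ x∈a x∈b y∈a y∈b with y ≟ x
  ... | yes y≡x = y≡x
  ... | no  y≢x with split a∈ b∈ (λ z → (z ≟ x) ⊎-dec ¬? (z ∈? b))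
  ...   | e , e∈ , e⊆a∪b , inj₁ e⊆S =
    Sum.[ id , contradiction y∈b ] (e⊆S (subst (y ∈_) (sym e≡a) y∈a))
    where
    e⊆a : e ⊆ a
    e⊆a z∈e with e⊆S z∈e | e⊆a∪b z∈e
    ... | inj₁ refl | _        = x∈a
    ... | inj₂ z∉b  | inj₁ z∈a = z∈a
    ... | inj₂ z∉b  | inj₂ z∈b = contradiction z∈b z∉b

    e≡a : e ≡ a
    e≡a = ⊆⇒≡ e∈ (inj₁ a∈) e⊆a
  ...   | e , e∈ , e⊆a∪b , inj₂ e⊆∁S =
    contradiction (inj₁ refl) (e⊆∁S (subst (x ∈_) (sym e≡b) x∈b))
    where
    e⊆b : e ⊆ b
    e⊆b {z} z∈e = decidable-stable (z ∈? b) (e⊆∁S z∈e ∘ inj₂)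

    e≡b : e ≡ b
    e≡b = ⊆⇒≡ e∈ (inj₂ b∈) e⊆b

  -- Split `a ∪ b` into `p` with `b` minus `x`, and the rest, which lies in `a` minus `p` and so
  -- contains no edge. An edge in the first part must use `p`, or it would lie in `b` without `x`.
  star : ∀ {a b x p} → A a → B b → x ∈ a → x ∈ b → p ∈ a → p ≢ x →
         ∃[ f ] Edge f × p ∈ f × x ∉ f × (∀ {z} → z ∈ f → z ≢ p → z ∈ b)
  star {a} {b} {x} {p} a∈ b∈ x∈a x∈b p∈a p≢x
    with split a∈ b∈ (λ z → ((z ∈? b) ×-dec ¬? (z ≟ x)) ⊎-dec (z ≟ p))
  ... | f , f∈ , f⊆a∪b , inj₁ f⊆S = f , f∈ , p∈f , x∉f , f-p⊆b
    where
    x∉f : x ∉ f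
    x∉f x∈f with f⊆S x∈f
    ... | inj₁ (_ , x≢x) = x≢x refl
    ... | inj₂ x≡p       = p≢x (sym x≡p)

    f-p⊆b : ∀ {z} → z ∈ f → z ≢ p → z ∈ b
    f-p⊆b z∈f z≢p with f⊆S z∈f
    ... | inj₁ (z∈b , _) = z∈b
    ... | inj₂ z≡p       = contradiction z≡p z≢p

    p∈f : p ∈ f
    p∈f = decidable-stable (p ∈? f) λ p∉f →
      let f⊆b : f ⊆ b
          f⊆b z∈f = f-p⊆b z∈f λ z≡p → p∉f (subst (_∈ f) z≡p z∈f)
      in x∉f (subst (x ∈_) (sym (⊆⇒≡ f∈ (inj₂ b∈) f⊆b)) x∈b)
  ... | f , f∈ , f⊆a∪b , inj₂ f⊆∁S =
    contradiction (inj₂ refl) (f⊆∁S (subst (p ∈_) (sym (⊆⇒≡ f∈ (inj₁ a∈) f⊆a)) p∈a))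
    where
    f⊆a : f ⊆ a
    f⊆a {z} z∈f with f⊆a∪b z∈f
    ... | inj₁ z∈a = z∈a
    ... | inj₂ z∈b with z ≟ x
    ...   | yes refl = x∈a
    ...   | no z≢x   = contradiction (inj₁ (z∈b , z≢x)) (f⊆∁S z∈f)

  -- If the edge f of `star` lies in A, it meets b in one vertex only.
  star-pair : ∀ {b p f} → B b → A f → p ∈ f → (∀ {z} → z ∈ f → z ≢ p → z ∈ b) →
              ∃[ q ] A (pair p q)
  star-pair {b} {p} {f} b∈ f∈ p∈f f-p⊆b with other (inj₁ f∈) p
  ... | q , q∈f , q≢p = q , subst A (pair-edge (inj₁ f∈) f⊆pq) f∈
    where
    f⊆pq : ∀ {z} → z ∈ f → z ≡ p ⊎ z ≡ q
    f⊆pq {z} z∈f with z ≟ p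
    ... | yes z≡p = inj₁ z≡p
    ... | no z≢p  = inj₂ (∩-unique f∈ b∈ q∈f (f-p⊆b q∈f q≢p) z∈f (f-p⊆b z∈f z≢p))

  -- Neither a single vertex `x` nor `b` minus `x` contains an edge, so some edge avoids `b`; it is
  -- not in `A`, whose edges all meet `b`.
  twin : ∀ {b} → B b → ∃[ b′ ] B b′ × (∀ {z} → z ∈ b → z ∉ b′)
  twin {b} b∈ with distinct (inj₂ b∈)
  ... | x , _ , x∈b , _ with block (λ z → z ≟ x) (λ z → z ∈? b)
  ...   | e , zero , e∈ , e⊆x =
    let y , y∈e , y≢x = other e∈ x in contradiction (e⊆x y∈e) y≢x
  ...   | e , suc zero , e∈ , e⊆b-x =
    contradiction refl
      (proj₁ (e⊆b-x (subst (x ∈_) (sym (⊆⇒≡ e∈ (inj₂ b∈) (proj₂ ∘ e⊆b-x))) x∈b)))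
  ...   | e , suc (suc zero) , inj₁ e∈A , e⊆∁b =
    let z , z∈e , z∈b = cross e∈A b∈ in contradiction z∈b (proj₂ (e⊆∁b z∈e))
  ...   | e , suc (suc zero) , inj₂ e∈B , e⊆∁b =
    e , e∈B , λ z∈b z∈e → proj₂ (e⊆∁b z∈e) z∈b

-- Two-vertex edges and the complete bipartite graph they form.

module _ {A B : Pred (Subset n) 0ℓ} (U : Uncolorable A B) where
  open Uncolorable U

  -- Otherwise `with pair-link …` normalises the whole proof term.
  abstract
    pair-link : ∀ {p q r b} → A (pair p q) → B b → p ∈ b → r ∈ b → r ≢ p →
                Edge (pair q r)
    pair-link {p} {q} {r} pq∈ b∈ p∈b r∈b r≢p
      -- With the roles exchanged, the star edge through `r` has its remaining vertices in
      -- `pair p q` but avoids the common vertex `p`, which leaves only `q`.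
      with star (swap U) b∈ pq∈ p∈b (∈-pairˡ p q) r∈b r≢p
    ... | g , g∈ , r∈g , p∉g , g-r⊆pq =
      subst Edge (pair-edge (Sum.swap g∈) g⊆qr) (Sum.swap g∈)
      where
      g⊆qr : ∀ {z} → z ∈ g → z ≡ q ⊎ z ≡ r
      g⊆qr {z} z∈g with z ≟ r
      ... | yes z≡r = inj₂ z≡r
      ... | no z≢r with ∈-pair⁻ (g-r⊆pq z∈g z≢r)
      ...   | inj₁ refl = contradiction z∈g p∉g
      ...   | inj₂ z≡q  = inj₁ z≡q

  -- Descent with `a` fixed: each round either finds a two-vertex edge or replaces `b` by a star
  -- edge `f` in `B`.
  pair-exists : ∀ {a b} → A a → B b → Acc _⊂_ (b ∩ ∁ a) →
                (∃[ p ] ∃[ q ] A (pair p q)) ⊎ (∃[ p ] ∃[ q ] B (pair p q))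
  pair-exists {a} {b} a∈ b∈ (acc rec) with cross a∈ b∈
  ... | x , x∈a , x∈b with other (inj₂ b∈) x
  ... | q , q∈b , q≢x with star (swap U) b∈ a∈ x∈b x∈a q∈b q≢x
  ... | g , inj₁ g∈B , q∈g , _ , g-q⊆a =
    inj₂ (q , star-pair (swap U) a∈ g∈B q∈g g-q⊆a)
  ... | g , inj₂ g∈A , q∈g , x∉g , g-q⊆a with other (inj₁ g∈A) q
  ... | p , p∈g , p≢q with g-q⊆a p∈g p≢q
  ... | p∈a with star U a∈ b∈ x∈a x∈b p∈a (λ p≡x → x∉g (subst (_∈ g) p≡x p∈g))
  ... | f , inj₁ f∈A , p∈f , _ , f-p⊆b = inj₁ (p , star-pair U b∈ f∈A p∈f f-p⊆b)
  ... | f , inj₂ f∈B , p∈f , _ , f-p⊆b =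
    -- Nothing enters the difference, because the only vertex of `f` that may lie outside `b` is
    -- `p`, which is in `a`. The vertex `q` leaves it, because `g` and `f` share only `p`.
    pair-exists a∈ f∈B (rec (f─a⊆b─a , q , q∈b─a , q∉f ∘ proj₁ ∘ x∈p∩q⁻ f (∁ a)))
    where
    q∉f : q ∉ f
    q∉f q∈f = p≢q (sym (∩-unique U g∈A f∈B p∈g p∈f q∈g q∈f))

    q∈b─a : q ∈ b ∩ ∁ a
    q∈b─a = x∈p∩q⁺ (q∈b , x∉p⇒x∈∁p λ q∈a → q≢x (∩-unique U a∈ b∈ x∈a x∈b q∈a q∈b))

    f─a⊆b─a : f ∩ ∁ a ⊆ b ∩ ∁ a
    f─a⊆b─a z∈ with x∈p∩q⁻ f (∁ a) z∈
    ... | z∈f , z∈∁a =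
      x∈p∩q⁺ (f-p⊆b z∈f (λ z≡p → x∈∁p⇒x∉p z∈∁a (subst (_∈ a) (sym z≡p) p∈a)) , z∈∁a)

  -- The pairs determine both families. An edge of `B` that misses some `r` in `b` must meet every
  -- `pair r s`, hence contains `b′`. An edge of `A` meets both sides, hence contains some
  -- `pair r s`. The Sperner property turns these inclusions into equalities.
  bipartite⇒exceptional : ∀ {b b′} → B b → B b′ → (∀ {z} → z ∈ b → z ∉ b′) →
                          (∀ {r s} → r ∈ b → s ∈ b′ → A (pair r s)) → Exceptional A B
  bipartite⇒exceptional {b} {b′} b∈ b′∈ b#b′ rs∈A = record
    { m           = ∣ b ∣
    ; l           = ∣ b′ ∣
    ; 2≤m         = let x , y , x∈ , y∈ , x≢y = distinct (inj₂ b∈) in 2≤∣ b ∣ x∈ y∈ x≢y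
    ; 2≤l         = let x , y , x∈ , y∈ , x≢y = distinct (inj₂ b′∈) in 2≤∣ b′ ∣ x∈ y∈ x≢y
    ; v           = enumerate b
    ; u           = enumerate b′
    ; v-injective = enumerate-injective b
    ; u-injective = enumerate-injective b′
    ; v≢u         = λ i j vᵢ≡uⱼ → b#b′ (enumerate-∈ b i)
                                       (subst (_∈ b′) (sym vᵢ≡uⱼ) (enumerate-∈ b′ j))
    ; V-covered   = λ e∈ x∈e → Sum.map (enumerate-surjective b) (enumerate-surjective b′)
                                       (covered e∈ x∈e)
    ; B-edges     = λ e → mk⇔ (Sum.map (λ e≡b → trans e≡b (sym (image-enumerate b)))
                                       (λ e≡b′ → trans e≡b′ (sym (image-enumerate b′)))
                                ∘ B-edge)
                              Sum.[ (λ { refl → subst B (sym (image-enumerate b)) b∈ })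
                                  , (λ { refl → subst B (sym (image-enumerate b′)) b′∈ }) ]
    ; A-edges     = λ e → mk⇔ A-enumerated
                              (λ { (i , j , refl) → rs∈A (enumerate-∈ b i) (enumerate-∈ b′ j) })
    }
    where
    B-edge : ∀ {e} → B e → e ≡ b ⊎ e ≡ b′
    B-edge {e} e∈ with ⊆⊎∃∉ b e
    ... | inj₁ b⊆e             = inj₁ (sym (⊆⇒≡ (inj₂ b∈) (inj₂ e∈) b⊆e))
    ... | inj₂ (r , r∈b , r∉e) = inj₂ (sym (⊆⇒≡ (inj₂ b′∈) (inj₂ e∈) b′⊆e))
      where
      b′⊆e : b′ ⊆ e
      b′⊆e s∈b′ with cross (rs∈A r∈b s∈b′) e∈
      ... | z , z∈rs , z∈e with ∈-pair⁻ z∈rs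
      ...   | inj₁ refl = contradiction z∈e r∉e
      ...   | inj₂ refl = z∈e

    A-edge : ∀ {e} → A e → ∃[ r ] ∃[ s ] r ∈ b × s ∈ b′ × e ≡ pair r s
    A-edge e∈ with cross e∈ b∈ | cross e∈ b′∈
    ... | r , r∈e , r∈b | s , s∈e , s∈b′ =
      r , s , r∈b , s∈b′ ,
      sym (⊆⇒≡ (inj₁ (rs∈A r∈b s∈b′)) (inj₁ e∈) (pair-⊆ r∈e s∈e))

    A-enumerated : ∀ {e} → A e → ∃[ i ] ∃[ j ] e ≡ pair (enumerate b i) (enumerate b′ j)
    A-enumerated e∈ with A-edge e∈
    ... | r , s , r∈b , s∈b′ , e≡rs
      with enumerate-surjective b r∈b | enumerate-surjective b′ s∈b′
    ...   | i , refl | j , refl = i , j , e≡rs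

    covered : ∀ {e x} → Edge e → x ∈ e → x ∈ b ⊎ x ∈ b′
    covered (inj₁ e∈A) x∈e with A-edge e∈A
    ... | r , s , r∈b , s∈b′ , refl with ∈-pair⁻ x∈e
    ...   | inj₁ refl = inj₁ r∈b
    ...   | inj₂ refl = inj₂ s∈b′
    covered (inj₂ e∈B) x∈e with B-edge e∈B
    ... | inj₁ refl = inj₁ x∈e
    ... | inj₂ refl = inj₂ x∈e

  -- One vertex `q` of `b′` joined to all of `b` suffices, since `pair-link` carries `q` to any
  -- other `s` in `b′`.
  fan⇒exceptional : ∀ {q b b′} → B b → B b′ → (∀ {z} → z ∈ b → z ∉ b′) → q ∈ b′ →
                    (∀ {r} → r ∈ b → A (pair q r)) → Exceptional A B
  fan⇒exceptional {q} {b} {b′} b∈ b′∈ b#b′ q∈b′ qr∈A =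
    bipartite⇒exceptional b∈ b′∈ b#b′ rs∈A
    where
    rs∈A : ∀ {r s} → r ∈ b → s ∈ b′ → A (pair r s)
    rs∈A {r} {s} r∈b s∈b′ with s ≟ q
    ... | yes refl = subst A (pair-comm s r) (qr∈A r∈b)
    ... | no s≢q with pair-link (qr∈A r∈b) b′∈ q∈b′ s∈b′ s≢q
    ...   | inj₁ rs∈A = rs∈A
    ...   | inj₂ rs∈B =
      -- If `pair r s` were in `B`, it would have to meet `pair q t` for another vertex `t` of `b`,
      -- but these four vertices are distinct.
      let t , t∈b , t≢r    = other (inj₂ b∈) r
          z , z∈qt , z∈rs = cross (qr∈A t∈b) rs∈B
      in contradiction z∈rs
           (∉-pair (λ { refl → b#b′ r∈b q∈b′ }) (s≢q ∘ sym) t≢r (λ { refl → b#b′ t∈b s∈b′ }) z∈qt)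

  -- The twin of `pair q r` must meet `pair p q` and hence contains `p`, so `p` is the apex of a fan
  -- over `pair q r`.
  triangle⇒exceptional : ∀ {p q r} → A (pair p q) → A (pair p r) → B (pair q r) →
                         Exceptional A B
  triangle⇒exceptional {p} {q} {r} pq∈ pr∈ qr∈ with twin U qr∈
  ... | b′ , b′∈ , qr#b′ = fan⇒exceptional qr∈ b′∈ qr#b′ p∈b′ ps∈A
    where
    p∈b′ : p ∈ b′
    p∈b′ with cross pq∈ b′∈
    ... | z , z∈pq , z∈b′ with ∈-pair⁻ z∈pq
    ...   | inj₁ refl = z∈b′
    ...   | inj₂ refl = contradiction z∈b′ (qr#b′ (∈-pairˡ q r))

    ps∈A : ∀ {s} → s ∈ pair q r → A (pair p s)
    ps∈A s∈qr with ∈-pair⁻ s∈qr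
    ... | inj₁ refl = pq∈
    ... | inj₂ refl = pr∈

-- From one two-vertex edge to the exceptional family.

module _ {A B : Pred (Subset n) 0ℓ} (U : Uncolorable A B) where
  open Uncolorable U

  -- Either every `pair q r` with `r` in `b` lies in `A`, a fan at `q`, or one of them lies in `B`
  -- only. In that case `pair-link` also makes `pair p r` an edge, and whichever family holds it, a
  -- triangle with two sides in one family and one in the other results.
  crossed-pair⇒exceptional : ∀ {p q b} → A (pair p q) → B b → p ∈ b →
                             Exceptional A B ⊎ Exceptional B A
  crossed-pair⇒exceptional {p} {q} {b} pq∈ b∈ p∈b
    with any? (λ r → (r ∈? b) ×-dec ¬? (A? (pair q r)))
  ... | no ¬∃r with twin U b∈
  ...   | b′ , b′∈ , b#b′ =
    inj₁ (fan⇒exceptional U b∈ b′∈ b#b′ q∈b′ λ {r} r∈b →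
      decidable-stable (A? (pair q r)) λ qr∉A → ¬∃r (r , r∈b , qr∉A))
    where
    q∈b′ : q ∈ b′
    q∈b′ with cross pq∈ b′∈
    ... | z , z∈pq , z∈b′ with ∈-pair⁻ z∈pq
    ...   | inj₁ refl = contradiction z∈b′ (b#b′ p∈b)
    ...   | inj₂ refl = z∈b′
  crossed-pair⇒exceptional {p} {q} {b} pq∈ b∈ p∈b | yes (r , r∈b , qr∉A)
    with pair-link U pq∈ b∈ p∈b r∈b (λ { refl → qr∉A (subst A (pair-comm p q) pq∈) })
  ... | inj₁ qr∈A = contradiction qr∈A qr∉A
  ... | inj₂ qr∈B with pair-link U (subst A (pair-comm p q) pq∈) qr∈B
                         (∈-pairˡ q r) (∈-pairʳ q r) r≢q
    where
    r≢q : r ≢ q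
    r≢q refl = let y , y∈ , y≢q = other (inj₂ qr∈B) q in
      Sum.[ y≢q , y≢q ] (∈-pair⁻ y∈)
  ...   | inj₁ pr∈A = inj₁ (triangle⇒exceptional U pq∈ pr∈A qr∈B)
  ...   | inj₂ pr∈B =
    inj₂ (triangle⇒exceptional (swap U) (subst B (pair-comm q r) qr∈B)
                                        (subst B (pair-comm p r) pr∈B)
                                        (subst A (pair-comm p q) pq∈))

  pair⇒exceptional : ∀ {p q b} → A (pair p q) → B b → Exceptional A B ⊎ Exceptional B A
  pair⇒exceptional {p} {q} pq∈ b∈ with cross pq∈ b∈
  ... | z , z∈pq , z∈b with ∈-pair⁻ z∈pq
  ...   | inj₁ refl = crossed-pair⇒exceptional pq∈ b∈ z∈b
  ...   | inj₂ refl = crossed-pair⇒exceptional (subst A (pair-comm p q) pq∈) b∈ z∈b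

uncolorable⇒exceptional : {A B : Pred (Subset n) 0ℓ} → Uncolorable A B → ∃ A → ∃ B →
                          Exceptional A B ⊎ Exceptional B A
uncolorable⇒exceptional U (a , a∈) (b , b∈)
  with pair-exists U a∈ b∈ (⊂-wellFounded (b ∩ ∁ a))
... | inj₁ (_ , _ , pq∈A) = pair⇒exceptional U pq∈A b∈
... | inj₂ (_ , _ , pq∈B) = Sum.swap (pair⇒exceptional (swap U) pq∈B a∈)

-- From the chromatic number to the combinatorial hypotheses.

module _ (H : Hypergraph n) where
  open Hypergraph H

  monochromatic? : ∀ {k} (c : Fin n → Fin k) → Decidable (λ e → Monochromatic H c e)
  monochromatic? c e =
    map′ (λ mono {x} {y} → mono x y) (λ mono x y → mono {x} {y})
         (all? λ x → all? λ y → (x ∈? e) →-dec (y ∈? e) →-dec (c x ≟ c y))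

  colorable⇒distinct : ∀ {k} → Colorable H k → ∀ {e} → Edge e →
                       ∃[ x ] ∃[ y ] x ∈ e × y ∈ e × x ≢ y
  colorable⇒distinct (c , proper) {e} e∈
    with any? (λ x → any? λ y → (x ∈? e) ×-dec (y ∈? e) ×-dec ¬? (x ≟ y))
  ... | yes xy = xy
  ... | no ¬xy = ⊥-elim (proper e∈ λ {x} {y} → mono {x} {y})
    where
    mono : Monochromatic H c e
    mono {x} {y} x∈e y∈e = cong c (decidable-stable (x ≟ y) λ x≢y → ¬xy (x , y , x∈e , y∈e , x≢y))

  -- The witness comes constructively from a search through the finitely many subsets, edges and
  -- monochromaticity being decidable.
  uncolorable⇒monochromatic : ∀ {k} → ¬ Colorable H k → (c : Fin n → Fin k) →
                              ∃[ e ] Edge e × Monochromatic H c e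
  uncolorable⇒monochromatic ¬col c
    with anySubset? (λ e → edge? e ×-dec monochromatic? c e)
  ... | yes w = w
  ... | no ¬w = ⊥-elim (¬col (c , λ {e} e∈ mono → ¬w (e , e∈ , λ {x} {y} → mono {x} {y})))

sperner⇒≡ : ∀ {H : Hypergraph n} → Sperner H → let open Hypergraph H in
            ∀ {e f} → Edge e → Edge f → e ⊆ f → e ≡ f
sperner⇒≡ sp {e} {f} e∈ f∈ e⊆f with ⊆⊎∃∉ f e
... | inj₁ f⊆e = ⊆-antisym e⊆f f⊆e
... | inj₂ f⊈e = ⊥-elim (sp e∈ f∈ ((λ {x} → e⊆f {x}) , f⊈e))

theorem1p5 : (n : ℕ) (H : CrossIntersectingFamily n) →
    let open CrossIntersectingFamily H in
    Sperner hypergraph →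
    (χ : ℕ) → IsChromaticNumber hypergraph χ →
    χ ≤ 3 ⊎ (Exceptional A B ⊎ Exceptional B A)
theorem1p5 n H sp χ (χ-colorable , χ-minimal) with χ ≤? 3
... | yes χ≤3 = inj₁ χ≤3
... | no  χ≰3 = inj₂ (uncolorable⇒exceptional U A-nonempty B-nonempty)
  where
  open CrossIntersectingFamily H

  U : Uncolorable A B
  U = record
    { A?            = A?
    ; B?            = B?
    ; cross         = λ {a} {b} a∈ b∈ →
                        let x , x∈a∩b = cross a∈ b∈ in x , x∈p∩q⁻ a b x∈a∩b
    ; ⊆⇒≡           = sperner⇒≡ {H = hypergraph} sp
    -- A proper coloring with any number of colors excludes edges with fewer than two vertices; the
    -- one with `χ` colors is at hand.
    ; distinct      = colorable⇒distinct hypergraph χ-colorable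
    ; monochromatic = uncolorable⇒monochromatic hypergraph (χ≰3 ∘ χ-minimal)
    }
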